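{- For every integer $n\ge 0$, $$\sum_{p=0}^{\lfloor n/2\rfloor}\frac{1}{2p+1}\binom{3p}{p}\binom{n+p}{3p}=\frac{1}{n+1}\binom{2n}{n},$$ and for every integer $n\ge 1$, $$\sum_{p=0}^{\lfloor (n-1)/2\rfloor}\frac{1}{2p+1}\binom{3p+1}{p+1}\binom{n+p}{3p+1}=\frac{1}{n+1}\binom{2n}{n}.$$ -}

module Defs where

open import Data.Fin.Base using (toℕ)
open import Data.Integer.Base using (+_)
open import Data.Nat.Base using (ℕ; suc)
open import Data.Nat.Combinatorics using (_C_)
open import Data.Rational.Base using (ℚ; _/_)
open import Data.Rational.Properties using (+-0-commutativeMonoid)
open import Algebra.Properties.CommutativeMonoid.Sum +-0-commutativeMonoid using (sum)

-- The upper bound m is attained: the sum has suc m terms.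
sum≤ : ℕ → (ℕ → ℚ) → ℚ
sum≤ m f = sum {suc m} (λ i → f (toℕ i))

infixl 5 sum≤
syntax sum≤ m (λ p → x) = ∑[ p ≤ m ] x

binom : ℕ → ℕ → ℚ
binom n k = + (n C k) / 1

{-# OPTIONS --safe #-}

-- Clearing denominators, the p-th terms of the two sums are
--   (n+p choose p) (n+1 choose n-2p) / (n+1)  and  (n+p choose p+1) (n choose n-1-2p) / n.
-- Both sums therefore read off coefficients of
--   (1 - x²)^(-m) (1 + x)^m = (1 - x)^(-m),
-- namely that of x^n for m = n + 1 and that of x^(n+1) for m = n, where the term p = -1 vanishes.
module Submission where

open import Defs
open import Data.Integer.Base using (+_)
open import Data.Nat.Base using (ℕ; _+_; _∸_; _≥_; ⌊_/2⌋) renaming (_*_ to _·_)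
open import Data.Product.Base using (_×_)
open import Data.Rational.Base using (_/_; _*_)
open import Relation.Binary.PropositionalEquality.Core using (_≡_)

import Data.Integer.Base as ℤ
import Data.Integer.Properties as ℤ
open import Data.Nat.Base using (zero; suc; _!; NonZero)
open import Data.Nat.Combinatorics
open import Data.Nat.DivMod using (m/n*n≡m)
open import Data.Nat.Properties
open import Data.Nat.Tactic.RingSolver using (solve-∀)
open import Data.Product.Base using (_,_)
import Data.Rational.Base as ℚ
import Data.Rational.Properties as ℚ
open import Data.Rational.Unnormalised.Base as ℚᵘ using (mkℚᵘ; *≡*)
import Data.Rational.Unnormalised.Properties as ℚᵘ
open import Function.Base using (_∘_)
open import Relation.Binary.PropositionalEquality
  using (refl; sym; trans; cong; cong₂; module ≡-Reasoning)

open ≡-Reasoning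

-- Binomial coefficients through factorials.

[k+m]Ck*k!*m!≡[k+m]! : ∀ k m → ((k + m) C k) · (k ! · m !) ≡ (k + m) !
[k+m]Ck*k!*m!≡[k+m]! k m = begin
  ((k + m) C k) · (k ! · m !)
    ≡⟨ cong (λ j → ((k + m) C k) · (k ! · j !)) (sym (m+n∸m≡n k m)) ⟩
  ((k + m) C k) · (k ! · (k + m ∸ k) !)
    ≡⟨ cong (_· (k ! · (k + m ∸ k) !)) (nCk≡n!/k![n-k]! (m≤m+n k m)) ⟩
  _ ≡⟨ m/n*n≡m (k![n∸k]!∣n! (m≤m+n k m)) ⟩
  (k + m) ! ∎
  where instance _ = k !* (k + m ∸ k) !≢0

[k+m]Ck≡[k+m]Cm : ∀ k m → (k + m) C k ≡ (k + m) C m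
[k+m]Ck≡[k+m]Cm k m =
  trans (nCk≡nC[n∸k] (m≤m+n k m)) (cong ((k + m) C_) (m+n∸m≡n k m))

-- Multiplied by `a ! · b ! · c !`, both sides become `suc (b + c) · (a + b + c) !`. The purpose is
-- to trade a denominator `suc b`, which varies along the sums, for `suc (b + c)`, which does not.
absorb-trinomial : ∀ a b c →
  suc (b + c) · (((a + b) C a) · ((a + b + c) C (a + b)))
    ≡ suc b · (((a + b + c) C a) · (suc (b + c) C c))
absorb-trinomial a b c = *-cancelʳ-≡ _ _ (a ! · b ! · c !) (begin
  s · (x · y) · (a ! · b ! · c !)
    ≡⟨ l₁ s x y (a !) (b !) (c !) ⟩
  s · (y · (x · (a ! · b !) · c !))
    ≡⟨ cong (λ t → s · (y · (t · c !))) ([k+m]Ck*k!*m!≡[k+m]! a b) ⟩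
  s · (y · ((a + b) ! · c !))
    ≡⟨ cong (s ·_) ([k+m]Ck*k!*m!≡[k+m]! (a + b) c) ⟩
  s · (a + b + c) !
    ≡⟨ cong (λ t → s · t !) (+-assoc a b c) ⟩
  s · (a + (b + c)) !
    ≡⟨ cong (s ·_) ([k+m]Ck*k!*m!≡[k+m]! a (b + c)) ⟨
  s · (((a + (b + c)) C a) · (a ! · (b + c) !))
    ≡⟨ cong (λ t → s · ((t C a) · (a ! · (b + c) !))) (+-assoc a b c) ⟨
  s · (u · (a ! · (b + c) !))
    ≡⟨ l₂ s u (a !) ((b + c) !) ⟩
  u · (a ! · (suc (b + c)) !)
    -- Splitting `suc (b + c)` as `suc b + c` produces `suc b !`, hence the factor `suc b` next to
    -- `b !`.
    ≡⟨ cong (λ t → u · (a ! · t)) ([k+m]Ck*k!*m!≡[k+m]! (suc b) c) ⟨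
  u · (a ! · ((suc (b + c) C suc b) · (suc b ! · c !)))
    ≡⟨ cong (λ t → u · (a ! · (t · (suc b ! · c !)))) ([k+m]Ck≡[k+m]Cm (suc b) c) ⟩
  u · (a ! · (v · (suc b ! · c !)))
    ≡⟨ l₃ u v (a !) (b !) (c !) b ⟩
  suc b · (u · v) · (a ! · b ! · c !) ∎)
  where
  s = suc (b + c)
  x = (a + b) C a
  y = (a + b + c) C (a + b)
  u = (a + b + c) C a
  v = suc (b + c) C c
  instance
    _ : NonZero (a ! · b ! · c !)
    _ = m*n≢0 (a ! · b !) (c !) {{a !* b !≢0}} {{c !≢0}}
  l₁ : ∀ s x y a b c → s · (x · y) · (a · b · c) ≡ s · (y · (x · (a · b) · c))
  l₁ = solve-∀
  l₂ : ∀ s u a d → s · (u · (a · d)) ≡ u · (a · (s · d))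
  l₂ = solve-∀
  l₃ : ∀ u v a f c b →
    u · (a · (v · (suc b · f · c))) ≡ suc b · (u · v) · (a · f · c)
  l₃ = solve-∀

-- Both sides times `k ! · m !` are the factorial of `suc (k + m)`.
C-neighbours : ∀ k m →
  suc m · ((k + suc m) C k) ≡ suc k · ((k + suc m) C suc k)
C-neighbours k m = *-cancelʳ-≡ _ _ (k ! · m !) (begin
  suc m · x · (k ! · m !)
    ≡⟨ l₁ m x (k !) (m !) ⟩
  x · (k ! · suc m !)
    ≡⟨ [k+m]Ck*k!*m!≡[k+m]! k (suc m) ⟩
  (k + suc m) !
    ≡⟨ cong _! (+-suc k m) ⟩
  suc (k + m) !
    ≡⟨ [k+m]Ck*k!*m!≡[k+m]! (suc k) m ⟨
  (suc (k + m) C suc k) · (suc k ! · m !)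
    ≡⟨ cong (λ t → (t C suc k) · (suc k ! · m !)) (+-suc k m) ⟨
  y · (suc k ! · m !)
    ≡⟨ l₂ k y (k !) (m !) ⟩
  suc k · y · (k ! · m !) ∎)
  where
  x = (k + suc m) C k
  y = (k + suc m) C suc k
  instance _ = k !* m !≢0
  l₁ : ∀ m x f g → suc m · x · (f · g) ≡ x · (f · (suc m · g))
  l₁ = solve-∀
  l₂ : ∀ k y f g → y · (suc k · f · g) ≡ suc k · y · (f · g)
  l₂ = solve-∀

-- Coefficients of (1 - x²)^(-a) (1 + x)^b.

-- The coefficient of x^q in (1 - x)^(-a); the truncated subtraction is harmless,
-- giving 1 at a = q = 0.
multichoose : ℕ → ℕ → ℕ
multichoose a q = (a + q ∸ 1) C q

multichoose-zeroˡ : ∀ q → multichoose 0 (suc q) ≡ 0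
multichoose-zeroˡ q = k>n⇒nCk≡0 (n<1+n q)

multichoose-suc : ∀ a q →
  multichoose (suc a) (suc q) ≡ multichoose (suc a) q + multichoose a (suc q)
multichoose-suc a q rewrite +-suc a q = sym (nCk+nC[k+1]≡[n+1]C[k+1] (a + q) q)

-- The coefficient of x^k in A(x²) B(x).
conv₂ : (ℕ → ℕ) → (ℕ → ℕ) → ℕ → ℕ
conv₂ A B 0             = A 0 · B 0
conv₂ A B 1             = A 0 · B 1
conv₂ A B (suc (suc k)) = A 0 · B (suc (suc k)) + conv₂ (A ∘ suc) B k

conv₂-sumˡ : ∀ {A A₁ A₂} B → (∀ q → A q ≡ A₁ q + A₂ q) →
  ∀ k → conv₂ A B k ≡ conv₂ A₁ B k + conv₂ A₂ B k
conv₂-sumˡ {A₁ = A₁} {A₂} B h 0 rewrite h 0 = *-distribʳ-+ (B 0) (A₁ 0) (A₂ 0)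
conv₂-sumˡ {A₁ = A₁} {A₂} B h 1 rewrite h 0 = *-distribʳ-+ (B 1) (A₁ 0) (A₂ 0)
conv₂-sumˡ {A₁ = A₁} {A₂} B h (suc (suc k))
  rewrite h 0 | conv₂-sumˡ B (h ∘ suc) k =
  lem (A₁ 0) (A₂ 0) (B (suc (suc k))) (conv₂ (A₁ ∘ suc) B k) (conv₂ (A₂ ∘ suc) B k)
  where
  lem : ∀ a a′ b c d → (a + a′) · b + (c + d) ≡ a · b + c + (a′ · b + d)
  lem = solve-∀

-- (1 - x²)^(-a-1) = x² (1 - x²)^(-a-1) + (1 - x²)^(-a)
conv₂-multichoose-suc : ∀ a B k →
  conv₂ (multichoose (suc a)) B (suc (suc k))
    ≡ conv₂ (multichoose (suc a)) B k + conv₂ (multichoose a) B (suc (suc k))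
conv₂-multichoose-suc a B k = begin
  b + conv₂ (multichoose (suc a) ∘ suc) B k
    -- Pascal's rule applies only from degree 1 on. In degree 0 both `multichoose (suc a)` and
    -- `multichoose a` are 1, so the leading term `b` can be handed over to `multichoose a`.
    ≡⟨ cong (λ t → b + t) (conv₂-sumˡ B (multichoose-suc a) k) ⟩
  b + (conv₂ (multichoose (suc a)) B k + conv₂ (multichoose a ∘ suc) B k)
    ≡⟨ lem b (conv₂ (multichoose (suc a)) B k) _ ⟩
  conv₂ (multichoose (suc a)) B k + (b + conv₂ (multichoose a ∘ suc) B k) ∎
  where
  b = 1 · B (suc (suc k))
  lem : ∀ b c d → b + (c + d) ≡ c + (b + d)
  lem = solve-∀

-- (1 + x)^(b+1) = x (1 + x)^b + (1 + x)^b
conv₂-C-suc : ∀ A b k →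
  conv₂ A (suc b C_) (suc k) ≡ conv₂ A (b C_) k + conv₂ A (b C_) (suc k)
conv₂-C-suc A b 0 rewrite sym (nCk+nC[k+1]≡[n+1]C[k+1] b 0) =
  *-distribˡ-+ (A 0) (b C 0) (b C 1)
-- Here the tail sits at index 0, where the induction hypothesis does not reach; `suc b C 0` and
-- `b C 0` are both 1.
conv₂-C-suc A b 1 rewrite sym (nCk+nC[k+1]≡[n+1]C[k+1] b 1) =
  lem (A 0) (A 1) (b C 1) (b C 2)
  where
  lem : ∀ a a′ x y → a · (x + y) + a′ · 1 ≡ a · x + (a · y + a′ · 1)
  lem = solve-∀
conv₂-C-suc A b (suc (suc k))
  rewrite sym (nCk+nC[k+1]≡[n+1]C[k+1] b (suc (suc k)))
        | conv₂-C-suc (A ∘ suc) b k =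
  lem (A 0) (b C suc (suc k)) (b C suc (suc (suc k)))
      (conv₂ (A ∘ suc) (b C_) k) (conv₂ (A ∘ suc) (b C_) (suc k))
  where
  lem : ∀ a x y c d → a · (x + y) + (c + d) ≡ a · x + c + (a · y + d)
  lem = solve-∀

conv₂-zeroˡ : ∀ {A} B → (∀ q → A q ≡ 0) → ∀ k → conv₂ A B k ≡ 0
conv₂-zeroˡ B h 0 rewrite h 0 = refl
conv₂-zeroˡ B h 1 rewrite h 0 = refl
conv₂-zeroˡ B h (suc (suc k)) rewrite h 0 = conv₂-zeroˡ B (h ∘ suc) k

-- (1 - x²)^(-m) (1 + x)^m = (1 - x)^(-m)
conv₂-multichoose-C : ∀ m k → conv₂ (multichoose m) (m C_) k ≡ multichoose m k
conv₂-multichoose-C zero    0 = refl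
conv₂-multichoose-C zero    1 = refl
conv₂-multichoose-C zero    (suc (suc k)) = begin
  1 · (0 C suc (suc k)) + conv₂ (multichoose 0 ∘ suc) (0 C_) k
    ≡⟨⟩
  conv₂ (multichoose 0 ∘ suc) (0 C_) k
    ≡⟨ conv₂-zeroˡ (0 C_) multichoose-zeroˡ k ⟩
  0
    ≡⟨ multichoose-zeroˡ (suc k) ⟨
  multichoose 0 (suc (suc k)) ∎
conv₂-multichoose-C (suc m) 0 = refl
conv₂-multichoose-C (suc m) 1 = begin
  1 · (suc m C 1)         ≡⟨ *-identityˡ _ ⟩
  suc m C 1               ≡⟨ cong (_C 1) (+-comm 1 m) ⟩
  multichoose (suc m) 1   ∎
conv₂-multichoose-C (suc m) (suc (suc k)) = begin
  G⁺ (suc m) (suc (suc k))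
    -- Lower the power of 1 + x, then in the second summand that of 1 / (1 - x²). The two remaining
    -- `G⁺ m` terms reassemble into `G⁺ (suc m) (suc k)`, which leaves Pascal's rule for (1 -
    -- x)^(-m-1).
    ≡⟨ conv₂-C-suc (multichoose (suc m)) m (suc k) ⟩
  G⁺ m (suc k) + G⁺ m (suc (suc k))
    ≡⟨ cong (λ t → G⁺ m (suc k) + t) (conv₂-multichoose-suc m (m C_) k) ⟩
  G⁺ m (suc k) + (G⁺ m k + G m (suc (suc k)))
    ≡⟨ lem (G⁺ m (suc k)) (G⁺ m k) _ ⟩
  G⁺ m k + G⁺ m (suc k) + G m (suc (suc k))
    ≡⟨ cong (λ t → t + G m (suc (suc k))) (conv₂-C-suc (multichoose (suc m)) m k) ⟨
  G⁺ (suc m) (suc k) + G m (suc (suc k))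
    ≡⟨ cong₂ _+_ (conv₂-multichoose-C (suc m) (suc k)) (conv₂-multichoose-C m (suc (suc k))) ⟩
  multichoose (suc m) (suc k) + multichoose m (suc (suc k))
    ≡⟨ multichoose-suc m (suc k) ⟨
  multichoose (suc m) (suc (suc k)) ∎
  where
  G⁺ G : ℕ → ℕ → ℕ
  G⁺ b = conv₂ (multichoose (suc m)) (b C_)
  G  b = conv₂ (multichoose m) (b C_)
  lem : ∀ x y z → x + (y + z) ≡ y + x + z
  lem = solve-∀

-- Fractions with natural numerators.

fromℚᵘ-homo-+ : ∀ p q → ℚ.fromℚᵘ p ℚ.+ ℚ.fromℚᵘ q ≡ ℚ.fromℚᵘ (p ℚᵘ.+ q)
fromℚᵘ-homo-+ p q = ℚ.toℚᵘ-injective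
  (ℚᵘ.≃-trans (ℚ.toℚᵘ-homo-+ (ℚ.fromℚᵘ p) (ℚ.fromℚᵘ q))
  (ℚᵘ.≃-trans (ℚᵘ.+-cong (ℚ.toℚᵘ-fromℚᵘ p) (ℚ.toℚᵘ-fromℚᵘ q))
              (ℚᵘ.≃-sym (ℚ.toℚᵘ-fromℚᵘ (p ℚᵘ.+ q)))))

fromℚᵘ-homo-* : ∀ p q → ℚ.fromℚᵘ p * ℚ.fromℚᵘ q ≡ ℚ.fromℚᵘ (p ℚᵘ.* q)
fromℚᵘ-homo-* p q = ℚ.toℚᵘ-injective
  (ℚᵘ.≃-trans (ℚ.toℚᵘ-homo-* (ℚ.fromℚᵘ p) (ℚ.fromℚᵘ q))
  (ℚᵘ.≃-trans (ℚᵘ.*-cong (ℚ.toℚᵘ-fromℚᵘ p) (ℚ.toℚᵘ-fromℚᵘ q))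
              (ℚᵘ.≃-sym (ℚ.toℚᵘ-fromℚᵘ (p ℚᵘ.* q)))))

-- `_/_` reduces to lowest terms, but it factors through unnormalised fractions, whose equality is
-- cross-multiplication; the comparison thus becomes one in ℕ.
/-cross : ∀ m n c d → suc d · m ≡ suc c · n → + m / suc c ≡ + n / suc d
/-cross m n c d eq = ℚ.fromℚᵘ-cong {mkℚᵘ (+ m) c} {mkℚᵘ (+ n) d} (*≡* (begin
  + m ℤ.* + suc d  ≡⟨ ℤ.pos-* m (suc d) ⟨
  + (m · suc d)    ≡⟨ cong (λ t → + t) (trans (*-comm m (suc d)) (trans eq (*-comm (suc c) n))) ⟩
  + (n · suc c)    ≡⟨ ℤ.pos-* n (suc c) ⟩
  + n ℤ.* + suc c  ∎))

/-homo-+ : ∀ c m n → (+ m / suc c) ℚ.+ (+ n / suc c) ≡ + (m + n) / suc c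
/-homo-+ c m n = begin
  (+ m / suc c) ℚ.+ (+ n / suc c)
    ≡⟨ fromℚᵘ-homo-+ (mkℚᵘ (+ m) c) (mkℚᵘ (+ n) c) ⟩
  (+ m ℤ.* + suc c ℤ.+ + n ℤ.* + suc c) / (suc c · suc c)
    ≡⟨ cong (_/ (suc c · suc c))
         (cong₂ ℤ._+_ (sym (ℤ.pos-* m (suc c))) (sym (ℤ.pos-* n (suc c)))) ⟩
  + (m · suc c + n · suc c) / (suc c · suc c)
    ≡⟨ /-cross (m · suc c + n · suc c) (m + n) _ c (lem (suc c) m n) ⟩
  + (m + n) / suc c ∎
  where
  lem : ∀ s m n → s · (m · s + n · s) ≡ s · s · (m + n)
  lem = solve-∀

/-*-/1 : ∀ c m n → (+ m / suc c) * (+ n / 1) ≡ + (m · n) / suc c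
/-*-/1 c m n = begin
  (+ m / suc c) * (+ n / 1)
    ≡⟨ fromℚᵘ-homo-* (mkℚᵘ (+ m) c) (mkℚᵘ (+ n) 0) ⟩
  (+ m ℤ.* + n) / (suc c · 1)
    ≡⟨ ℚ./-cong (sym (ℤ.pos-* m n)) (*-identityʳ (suc c)) ⟩
  + (m · n) / suc c ∎

1/-*-/1 : ∀ c n → (+ 1 / suc c) * (+ n / 1) ≡ + n / suc c
1/-*-/1 c n = trans (/-*-/1 c 1 n) (cong (λ t → + t / suc c) (*-identityˡ n))

-- From sums of fractions to coefficients.

-- Removing the term `p = 0` lowers `k` by 2, exactly as in the recursion of `conv₂`. The hypothesis
-- names r = k - 2p additively, so that no truncated subtraction enters the terms.
sum≤-conv₂ : ∀ c f A B k →
  (∀ p r → k ≡ 2 · p + r → f p ≡ + (A p · B r) / suc c) →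
  sum≤ ⌊ k /2⌋ f ≡ + conv₂ A B k / suc c
sum≤-conv₂ c f A B 0 h = trans (ℚ.+-identityʳ (f 0)) (h 0 0 refl)
sum≤-conv₂ c f A B 1 h = trans (ℚ.+-identityʳ (f 0)) (h 0 1 refl)
sum≤-conv₂ c f A B (suc (suc k)) h = begin
  f 0 ℚ.+ sum≤ ⌊ k /2⌋ (f ∘ suc)
    ≡⟨ cong₂ ℚ._+_ (h 0 (suc (suc k)) refl)
         (sum≤-conv₂ c (f ∘ suc) (A ∘ suc) B k λ p r eq →
           h (suc p) r (trans (cong (λ t → suc (suc t)) eq) (lem p r))) ⟩
  (+ (A 0 · B (suc (suc k))) / suc c) ℚ.+ (+ conv₂ (A ∘ suc) B k / suc c)
    ≡⟨ /-homo-+ c (A 0 · B (suc (suc k))) (conv₂ (A ∘ suc) B k) ⟩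
  + conv₂ A B (suc (suc k)) / suc c ∎
  where
  lem : ∀ p r → suc (suc (2 · p + r)) ≡ 2 · suc p + r
  lem = solve-∀

-- With `b = 2 · p` and `c = r`, the sum `b + c` is the index `k` of `sum≤-conv₂`, so all terms
-- share one denominator.
term-trinomial : ∀ a b c {k n} → k ≡ a + b → n ≡ a + b + c →
  (+ 1 / suc b) * binom k a * binom n k
    ≡ + ((n C a) · (suc (b + c) C c)) / suc (b + c)
term-trinomial a b c {k} {n} refl refl = begin
  (+ 1 / suc b) * binom k a * binom n k
    ≡⟨ cong (_* binom n k) (1/-*-/1 b (k C a)) ⟩
  (+ (k C a) / suc b) * binom n k
    ≡⟨ /-*-/1 b (k C a) (n C k) ⟩
  + ((k C a) · (n C k)) / suc b
    ≡⟨ /-cross ((k C a) · (n C k)) ((n C a) · (suc (b + c) C c)) b (b + c)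
         (absorb-trinomial a b c) ⟩
  + ((n C a) · (suc (b + c) C c)) / suc (b + c) ∎

-- The two identities.

first-sum : ∀ n →
  (∑[ p ≤ ⌊ n /2⌋ ] ((+ 1 / (1 + 2 · p)) * binom (3 · p) p * binom (n + p) (3 · p)))
    ≡ (+ 1 / (1 + n)) * binom (2 · n) n
first-sum n = begin
  _ ≡⟨ sum≤-conv₂ n _ (multichoose (suc n)) (suc n C_) n term ⟩
  + conv₂ (multichoose (suc n)) (suc n C_) n / suc n
    ≡⟨ cong (λ t → + t / suc n) (conv₂-multichoose-C (suc n) n) ⟩
  + ((n + n) C n) / suc n
    ≡⟨ cong (λ t → + ((n + t) C n) / suc n) (+-identityʳ n) ⟨
  + ((2 · n) C n) / suc n
    ≡⟨ 1/-*-/1 n ((2 · n) C n) ⟨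
  (+ 1 / (1 + n)) * binom (2 · n) n ∎
  where
  shift : ∀ p r → 2 · p + r + p ≡ p + 2 · p + r
  shift = solve-∀
  term : ∀ p r → n ≡ 2 · p + r →
    (+ 1 / (1 + 2 · p)) * binom (3 · p) p * binom (n + p) (3 · p)
      ≡ + (multichoose (suc n) p · (suc n C r)) / suc n
  term p r refl = term-trinomial p (2 · p) r refl (shift p r)

second-sum : ∀ m →
  (∑[ p ≤ ⌊ m /2⌋ ] ((+ 1 / (1 + 2 · p)) * binom (3 · p + 1) (p + 1) * binom (suc m + p) (3 · p + 1)))
    ≡ (+ 1 / (2 + m)) * binom (2 · suc m) (suc m)
second-sum m = begin
  _ ≡⟨ sum≤-conv₂ m _ (multichoose n ∘ suc) (n C_) m term ⟩
  + conv₂ (multichoose n ∘ suc) (n C_) m / n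
    -- Adjoin the vanishing term p = -1, with factor `n C suc n`: it undoes the shift of
    -- `multichoose n` and raises the degree from `m` to `suc n`, that is `m + 2`.
    ≡⟨ cong (λ t → + (1 · t + conv₂ (multichoose n ∘ suc) (n C_) m) / n)
         (k>n⇒nCk≡0 (n<1+n n)) ⟨
  + conv₂ (multichoose n) (n C_) (suc n) / n
    ≡⟨ cong (λ t → + t / n) (conv₂-multichoose-C n (suc n)) ⟩
  + ((m + suc n) C suc n) / n
    ≡⟨ cong (λ t → + (t C suc n) / n) (+-suc m n) ⟩
  + ((n + n) C suc n) / n
    -- The coefficient found is the neighbour of the central one; the ratio n : (n + 1) of the two
    -- also corrects the denominator.
    ≡⟨ /-cross ((n + n) C suc n) ((n + n) C n) m n (sym (C-neighbours n m)) ⟩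
  + ((n + n) C n) / suc n
    ≡⟨ cong (λ t → + ((n + t) C n) / suc n) (+-identityʳ n) ⟨
  + ((2 · n) C n) / suc n
    ≡⟨ 1/-*-/1 n ((2 · n) C n) ⟨
  (+ 1 / (1 + n)) * binom (2 · n) n ∎
  where
  n = suc m
  shift₁ : ∀ p → 3 · p + 1 ≡ p + 1 + 2 · p
  shift₁ = solve-∀
  shift₂ : ∀ p r → suc (2 · p + r) + p ≡ p + 1 + 2 · p + r
  shift₂ = solve-∀
  term : ∀ p r → m ≡ 2 · p + r →
    (+ 1 / (1 + 2 · p)) * binom (3 · p + 1) (p + 1) * binom (suc m + p) (3 · p + 1)
      ≡ + (multichoose (suc m) (suc p) · (suc m C r)) / suc m
  term p r refl = trans
    -- Now `a = p + 1`, while `b + c` is `m`, so the common denominator is `suc m` and not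
    -- `suc (suc m)`.
    (term-trinomial (p + 1) (2 · p) r (shift₁ p) (shift₂ p r))
    (cong₂ (λ t u → + ((t C u) · (suc m C r)) / suc m) (sym (+-suc m p)) (+-comm p 1))

corollary5p8 : ((n : ℕ) →
    (∑[ p ≤ ⌊ n /2⌋ ] ((+ 1 / (1 + 2 · p)) * binom (3 · p) p * binom (n + p) (3 · p)))
    ≡ (+ 1 / (1 + n)) * binom (2 · n) n)
    ×
    ((n : ℕ) → n ≥ 1 →
    (∑[ p ≤ ⌊ n ∸ 1 /2⌋ ] ((+ 1 / (1 + 2 · p)) * binom (3 · p + 1) (p + 1) * binom (n + p) (3 · p + 1)))
    ≡ (+ 1 / (1 + n)) * binom (2 · n) n)
corollary5p8 = first-sum , λ { (suc m) _ → second-sum m }
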